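{- Let $k\ge 2$ be a fixed integer, and let $G$ be a $k$-tree that contains a path on $n$ vertices. Then $G$ contains an induced path of size $\frac{\log (n-k-1)}{k \log k}=\frac{\log n}{k \log k}-O(\frac{1}{n})$.
   Context: The class of $k$-trees is defined recursively: any clique on $k$ vertices is a $k$-tree; and if $G$ has a vertex $v$ whose neighborhood is a clique of size exactly $k$ (a $k$-simplicial vertex) and $G\setminus v$ is a $k$-tree, then $G$ is a $k$-tree. The size of a path is its number of vertices. An induced path is a path that is an induced subgraph. Logarithms are base 2. -}

module Defs where

open import Data.Nat using (ℕ; suc; _≤_)
open import Data.Fin using (Fin; toℕ; punchIn)
open import Data.Fin.Subset using (Subset; ∣_∣)
open import Data.Vec using (tabulate)
open import Data.Bool using (Bool; true; false)
open import Data.Sum using (_⊎_)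
open import Relation.Binary.PropositionalEquality using (_≡_; _≢_)
open import Function.Definitions using (Injective)

record SimpleGraph (n : ℕ) : Set where
  field
    adj    : Fin n → Fin n → Bool
    sym    : ∀ u v → adj u v ≡ adj v u
    irrefl : ∀ v → adj v v ≡ false
open SimpleGraph public

delete : ∀ {n} → SimpleGraph (suc n) → Fin (suc n) → SimpleGraph n
delete G v = record
  { adj    = λ i j → adj G (punchIn v i) (punchIn v j)
  ; sym    = λ i j → sym G (punchIn v i) (punchIn v j)
  ; irrefl = λ i → irrefl G (punchIn v i)
  }

IsComplete : ∀ {n} → SimpleGraph n → Set
IsComplete {n} G = ∀ (u w : Fin n) → u ≢ w → adj G u w ≡ true

nbhd : ∀ {n} → SimpleGraph n → Fin n → Subset n
nbhd G v = tabulate (adj G v)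

NbhdIsClique : ∀ {n} → SimpleGraph n → Fin n → Set
NbhdIsClique {n} G v = ∀ (u w : Fin n) → adj G v u ≡ true → adj G v w ≡ true →
  u ≢ w → adj G u w ≡ true

data KTree (k : ℕ) : (n : ℕ) → SimpleGraph n → Set where
  clique : (G : SimpleGraph k) → IsComplete G → KTree k k G
  extend : ∀ {n} (G : SimpleGraph (suc n)) (v : Fin (suc n)) →
    NbhdIsClique G v → ∣ nbhd G v ∣ ≡ k → KTree k n (delete G v) →
    KTree k (suc n) G

IsPath : ∀ {n p} → SimpleGraph n → (Fin p → Fin n) → Set
IsPath {n} {p} G f = Injective _≡_ _≡_ f ×′
  (∀ (i j : Fin p) → toℕ j ≡ suc (toℕ i) → adj G (f i) (f j) ≡ true)
  where open import Data.Product using () renaming (_×_ to _×′_)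

IsInducedPath : ∀ {n p} → SimpleGraph n → (Fin p → Fin n) → Set
IsInducedPath {n} {p} G f = IsPath G f ×′
  (∀ (i j : Fin p) → adj G (f i) (f j) ≡ true →
     toℕ j ≡ suc (toℕ i) ⊎ toℕ i ≡ suc (toℕ j))
  where open import Data.Product using () renaming (_×_ to _×′_)

{-# OPTIONS --safe #-}

-- Fix a k-clique K, a component D of G − K, and a budget β j for each vertex K j.
-- If D contains a path on 2^(Σ β) vertices, then for some j there is an induced path
-- that starts at K j, continues inside D, and has more than β j vertices in D.
-- Indeed D contains a vertex v complete to K.  If some β j = 0, take the path K j, v.
-- Otherwise half of the given path avoids v, and its component in G − (K ∪ {v}) has no
-- neighbour K j for some j (G has no K_{k+2} minor).  Recurse on the clique K − K j + v,
-- giving v the budget β j − 1: a path found at v is prolonged by K j.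
-- For the theorem, halving the given path k times makes it avoid a k-clique K, and then
-- all budgets are taken equal; this gives the bound with 2 ^ (k * p) in place of k ^ (k * p).

module Submission where

open import Defs
open import Data.Nat using (ℕ; _≤_; _+_; _∸_; _*_; _^_)
open import Data.Fin using (Fin)
open import Data.Product using (Σ; _×_)

open import Data.Bool using (Bool; true; false; not; _∧_)
open import Data.Bool.Properties using (∧-conicalˡ; ∧-conicalʳ; ∧-zeroʳ; ¬-not) renaming (_≟_ to _≟ᵇ_)
open import Data.Fin using (zero; suc; toℕ; punchIn; punchOut; _↑ˡ_; _↑ʳ_; inject≤)
open import Data.Fin.Properties using (_≟_; any?; all?; injective⇒≤; toℕ-injective; toℕ<n; toℕ-↑ˡ; toℕ-↑ʳ; toℕ-inject≤; ¬∀⟶∃¬; punchIn-injective; punchInᵢ≢i; punchIn-punchOut; suc-injective)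
open import Data.Fin.Subset using (∣_∣)
open import Data.Nat using (zero; suc; z≤n; s≤s; _<_; NonZero; >-nonZero; _<?_)
import Data.Nat as ℕ
open import Data.Nat.Properties using (≤-refl; ≤-trans; <⇒≤; <⇒≱; n≮n; m≤n⇒m≤1+n; m∸n≤m; m≤m+n; m+n≡0⇒m≡0; *-suc; *-monoʳ-≤; *-monoˡ-≤; ^-monoˡ-≤; ^-monoʳ-≤; ^-*-assoc; m^n>0; ≮⇒≥; +-cancelˡ-≡; +-suc; +-identityʳ; +-monoˡ-≤; *-identityʳ; module ≤-Reasoning; ≤-reflexive; +-0-commutativeMonoid) renaming (suc-injective to ℕ-suc-injective)
open import Algebra.Properties.CommutativeMonoid.Sum +-0-commutativeMonoid using (sum; sum-remove)
open import Data.Product using (∃; _,_; proj₁; proj₂)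
open import Data.Sum using (_⊎_; inj₁; inj₂)
import Data.Sum as Sum
open import Data.Vec using (tabulate)
open import Data.Vec.Functional using (_∷_; insertAt; removeAt)
open import Data.Vec.Functional.Properties using (insertAt-lookup; insertAt-punchIn)
open import Function using (_∘_; id; const)
open import Function.Definitions using (Injective)
open import Relation.Binary.PropositionalEquality using (_≡_; _≢_; refl; trans; cong; cong₂; subst; subst₂) renaming (sym to ≡-sym)
open import Relation.Nullary using (Dec; yes; no; contradiction)
open import Relation.Nullary.Decidable using (_×-dec_; ¬?; decidable-stable; ⌊_⌋)

private
  variable
    a b k m n : ℕ

-- Tuples of vertices, pigeonhole, and listing a neighbourhood.

infix 4 _∈_ _∉_

_∈_ _∉_ : Fin n → (Fin b → Fin n) → Set
u ∈ K = ∃ λ i → K i ≡ u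
u ∉ K = ∀ i → K i ≢ u

_∈?_ : (u : Fin n) (K : Fin b → Fin n) → Dec (u ∈ K)
u ∈? K = any? λ i → K i ≟ u

∈⊎∉ : (u : Fin n) (K : Fin b → Fin n) → u ∈ K ⊎ u ∉ K
∈⊎∉ u K with u ∈? K
... | yes u∈K = inj₁ u∈K
... | no u∉K  = inj₂ λ i eq → u∉K (i , eq)

true≢false : {x : Bool} → x ≡ true → x ≢ false
true≢false refl ()

overflow : (A : Fin a → Fin n) (B : Fin b → Fin n) → Injective _≡_ _≡_ A → b < a →
  ∃ λ i → A i ∉ B
overflow A B inj b<a with all? (λ i → A i ∈? B)
... | yes A⊆B = contradiction
        (injective⇒≤ {f = λ i → proj₁ (A⊆B i)} λ {i} {j} eq →
          inj (trans (≡-sym (proj₂ (A⊆B i))) (trans (cong B eq) (proj₂ (A⊆B j)))))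
        (<⇒≱ b<a)
... | no A⊈B with ¬∀⟶∃¬ _ _ (λ i → A i ∈? B) A⊈B
...   | i , Ai∉B = i , λ j eq → Ai∉B (j , eq)

record Enumerates (h : Fin n → Bool) (e : Fin b → Fin n) : Set where
  field
    injective : Injective _≡_ _≡_ e
    sound     : ∀ i → h (e i) ≡ true
    complete  : ∀ x → h x ≡ true → x ∈ e

enumerate : (h : Fin n → Bool) → Σ (Fin ∣ tabulate h ∣ → Fin n) (Enumerates h)
enumerate {zero} h = (λ ()) , record
  { injective = λ { {()} } ; sound = λ () ; complete = λ () }
enumerate {suc n} h with h zero in h0 | enumerate (h ∘ suc)
... | true | e , E = zero ∷ (suc ∘ e) , record
  { injective = λ { {zero} {zero} _ → refl
                  ; {suc i} {suc j} eq → cong suc (E.injective (suc-injective eq)) }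
  ; sound     = λ { zero → h0 ; (suc i) → E.sound i }
  ; complete  = λ { zero _ → zero , refl
                  ; (suc x) hx → let i , eq = E.complete x hx in suc i , cong suc eq } }
  where module E = Enumerates E
... | false | e , E = suc ∘ e , record
  { injective = E.injective ∘ suc-injective
  ; sound     = E.sound
  ; complete  = λ { zero hx → contradiction h0 (true≢false hx)
                  ; (suc x) hx → let i , eq = E.complete x hx in i , cong suc eq } }
  where module E = Enumerates E

-- Listing N(w) as an injective `k`-tuple lets pigeonhole compare it with cliques, which are tuples
-- as well.
nbhd-enumeration : (G : SimpleGraph n) (w : Fin n) → ∣ nbhd G w ∣ ≡ k →
  Σ (Fin k → Fin n) (Enumerates (adj G w))
nbhd-enumeration G w refl = enumerate (adj G w)

-- Cliques, and unions of components outside a tuple of vertices.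

IsClique : SimpleGraph n → (Fin b → Fin n) → Set
IsClique G K = ∀ i j → i ≢ j → adj G (K i) (K j) ≡ true

adj⇒≢ : (G : SimpleGraph n) {u v : Fin n} → adj G u v ≡ true → u ≢ v
adj⇒≢ G {u} uv refl = true≢false uv (irrefl G u)

adj-sym : (G : SimpleGraph n) {u v : Fin n} → adj G u v ≡ true → adj G v u ≡ true
adj-sym G {u} {v} uv = trans (sym G v u) uv

clique-injective : (G : SimpleGraph n) {K : Fin b → Fin n} → IsClique G K → Injective _≡_ _≡_ K
clique-injective G cl {i} {j} eq with i ≟ j
... | yes i≡j = i≡j
... | no i≢j  = contradiction eq (adj⇒≢ G (cl i j i≢j))

∷-injective : {y : Fin n} {K : Fin b → Fin n} → y ∉ K → Injective _≡_ _≡_ K →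
  Injective _≡_ _≡_ (y ∷ K)
∷-injective y∉K inj {zero}  {zero}  _  = refl
∷-injective y∉K inj {zero}  {suc j} eq = contradiction (≡-sym eq) (y∉K j)
∷-injective y∉K inj {suc i} {zero}  eq = contradiction eq (y∉K i)
∷-injective y∉K inj {suc i} {suc j} eq = cong suc (inj eq)

∷-clique : (G : SimpleGraph n) {v : Fin n} {K : Fin b → Fin n} →
  (∀ i → adj G v (K i) ≡ true) → IsClique G K → IsClique G (v ∷ K)
∷-clique G vK cl zero    zero    0≢0 = contradiction refl 0≢0
∷-clique G vK cl zero    (suc j) _   = vK j
∷-clique G vK cl (suc i) zero    _   = adj-sym G (vK i)
∷-clique G vK cl (suc i) (suc j) i≢j = cl i j (i≢j ∘ cong suc)

removeAt-clique : (G : SimpleGraph n) {K : Fin (suc b) → Fin n} → IsClique G K →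
  ∀ m → IsClique G (removeAt K m)
removeAt-clique G cl m i j i≢j = cl _ _ (i≢j ∘ punchIn-injective m i j)

∈-removeAt : {K : Fin (suc b) → Fin n} {u : Fin n} (m : Fin (suc b)) →
  u ∈ K → K m ≢ u → u ∈ removeAt K m
∈-removeAt {K = K} m (i , Ki≡u) Km≢u = punchOut m≢i , trans (cong K (punchIn-punchOut m≢i)) Ki≡u
  where
  m≢i : m ≢ i
  m≢i refl = Km≢u Ki≡u

-- Equivalently: D is a union of components of G − K.
record Closed (G : SimpleGraph n) (K : Fin b → Fin n) (D : Fin n → Bool) : Set where
  field
    avoids : ∀ i → D (K i) ≡ false
    absorb : ∀ u t → D u ≡ true → adj G u t ≡ true → t ∉ K → D t ≡ true

  disjoint : ∀ {u} → D u ≡ true → u ∉ K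
  disjoint Du i refl = true≢false Du (avoids i)

outside : (Fin b → Fin n) → Fin n → Bool
outside K u = not ⌊ u ∈? K ⌋

outside-∉ : {K : Fin b → Fin n} {u : Fin n} → u ∉ K → outside K u ≡ true
outside-∉ {K = K} {u} u∉K with u ∈? K
... | yes (i , eq) = contradiction eq (u∉K i)
... | no _         = refl

outside-∈ : (K : Fin b → Fin n) {u : Fin n} → u ∈ K → outside K u ≡ false
outside-∈ K {u} u∈K with u ∈? K
... | yes _   = refl
... | no u∉K  = contradiction u∈K u∉K

-- Every set closed for `K` is contained in this one; the recursion starts from it once the path
-- avoids a clique.
outside-closed : (G : SimpleGraph n) (K : Fin b → Fin n) → Closed G K (outside K)
outside-closed G K = record
  { avoids = λ i → outside-∈ K (i , refl) ; absorb = λ _ _ _ _ → outside-∉ }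

-- Deleting a vertex and putting it back.

data PunchView (w : Fin (suc n)) : Fin (suc n) → Set where
  hit  : PunchView w w
  miss : ∀ u → PunchView w (punchIn w u)

-- Matching on the view turns a vertex into `w` or into a vertex of `delete G w`, where adjacency is
-- that of `G` by definition.
punchView : (w u : Fin (suc n)) → PunchView w u
punchView w u with w ≟ u
... | yes refl = hit
... | no w≢u   = subst (PunchView w) (punchIn-punchOut w≢u) (miss (punchOut w≢u))

lower : {w : Fin (suc n)} (K : Fin b → Fin (suc n)) → w ∉ K → Fin b → Fin n
lower K w∉K i = punchOut (w∉K i ∘ ≡-sym)

module _ (G : SimpleGraph (suc n)) {w : Fin (suc n)} (K : Fin b → Fin (suc n)) (w∉K : w ∉ K) where

  punchIn-lower : ∀ i → punchIn w (lower K w∉K i) ≡ K i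
  punchIn-lower i = punchIn-punchOut _

  ∉-lower : ∀ {u} → punchIn w u ∉ K → u ∉ lower K w∉K
  ∉-lower u∉K i refl = u∉K i (≡-sym (punchIn-lower i))

  lower-∉ : ∀ {u} → u ∉ lower K w∉K → punchIn w u ∉ K
  lower-∉ u∉ i eq = u∉ i (punchIn-injective w _ _ (trans (punchIn-lower i) eq))

  lower-adj : ∀ i {u} → adj G u (punchIn w (lower K w∉K i)) ≡ true → adj G u (K i) ≡ true
  lower-adj i = subst (λ t → adj G _ t ≡ true) (punchIn-lower i)

  lower-clique : IsClique G K → IsClique (delete G w) (lower K w∉K)
  lower-clique cl i j i≢j =
    subst₂ (λ s t → adj G s t ≡ true) (≡-sym (punchIn-lower i)) (≡-sym (punchIn-lower j)) (cl i j i≢j)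

  restrict-closed : ∀ {D} → Closed G K D → Closed (delete G w) (lower K w∉K) (D ∘ punchIn w)
  restrict-closed {D} c = record
    { avoids = λ i → trans (cong D (punchIn-lower i)) (Closed.avoids c i)
    ; absorb = λ u t Du ut t∉ → Closed.absorb c _ _ Du ut (lower-∉ t∉) }

-- Since N(w) is a clique, a component of G − w − K meeting N(w) already has N(w) in its closed neighbourhood.
extend-closed : (G : SimpleGraph (suc n)) (w : Fin (suc n)) → NbhdIsClique G w →
  (K : Fin b → Fin n) (D : Fin n → Bool) → Closed (delete G w) K D →
  ∃ λ D′ → Closed G (punchIn w ∘ K) D′ × (∀ u → D′ (punchIn w u) ≡ D u) ×
    (∀ u → adj G w (punchIn w u) ≡ true → D u ≡ true → D′ w ≡ true)
extend-closed G w simp K D c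
  -- `w` joins the set exactly when one of its neighbours is already in it.
  with any? (λ u → (adj G w (punchIn w u) ≟ᵇ true) ×-dec (D u ≟ᵇ true))
... | yes (d , wd , Dd) = D′ , record { avoids = λ i → trans (old _) (Closed.avoids c i) ; absorb = absorb }
                        , old , λ _ _ _ → new
  where
  D′ = insertAt D w true
  old : ∀ u → D′ (punchIn w u) ≡ D u
  old = insertAt-punchIn D w true
  new : D′ w ≡ true
  new = insertAt-lookup D w true
  absorb : ∀ u t → D′ u ≡ true → adj G u t ≡ true → t ∉ (punchIn w ∘ K) → D′ t ≡ true
  absorb u t Du ut t∉ with punchView w u | punchView w t
  ... | _      | hit    = new
  ... | miss u | miss t = trans (old t)
          (Closed.absorb c u t (trans (≡-sym (old u)) Du) ut λ i → t∉ i ∘ cong (punchIn w))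
  ... | hit    | miss t with d ≟ t
  ...   | yes refl = trans (old d) Dd
  ...   | no d≢t   = trans (old t) (Closed.absorb c d t Dd
            (simp _ _ wd ut (d≢t ∘ punchIn-injective w d t)) λ i → t∉ i ∘ cong (punchIn w))
... | no none = D′ , record { avoids = λ i → trans (old _) (Closed.avoids c i) ; absorb = absorb }
              , old , λ u wu Du → contradiction (u , wu , Du) none
  where
  D′ = insertAt D w false
  old : ∀ u → D′ (punchIn w u) ≡ D u
  old = insertAt-punchIn D w false
  absorb : ∀ u t → D′ u ≡ true → adj G u t ≡ true → t ∉ (punchIn w ∘ K) → D′ t ≡ true
  absorb u t Du ut t∉ with punchView w u | punchView w t
  ... | hit    | _      = contradiction (insertAt-lookup D w false) (true≢false Du)
  ... | miss u | hit    = contradiction (u , adj-sym G ut , trans (≡-sym (old u)) Du) none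
  ... | miss u | miss t = trans (old t)
          (Closed.absorb c u t (trans (≡-sym (old u)) Du) ut λ i → t∉ i ∘ cong (punchIn w))

closed-cong : {G : SimpleGraph n} {K L : Fin b → Fin n} {D : Fin n → Bool} →
  (∀ i → K i ≡ L i) → Closed G K D → Closed G L D
closed-cong {D = D} eq c = record
  { avoids = λ i → trans (cong D (≡-sym (eq i))) (Closed.avoids c i)
  ; absorb = λ u t Du ut t∉ → Closed.absorb c u t Du ut λ i → t∉ i ∘ trans (≡-sym (eq i)) }

-- Separation by (k+1)-cliques and common neighbours of k-cliques.

nbhd⊆⊎⊈ : (G : SimpleGraph n) (w : Fin n) {K : Fin b → Fin n} →
  (∀ y → adj G w y ≡ true → y ∈ K) ⊎ (∃ λ y → adj G w y ≡ true × y ∉ K)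
nbhd⊆⊎⊈ G w {K} with any? (λ y → (adj G w y ≟ᵇ true) ×-dec ¬? (y ∈? K))
... | yes (y , wy , y∉K) = inj₂ (y , wy , λ i eq → y∉K (i , eq))
... | no none = inj₁ λ y wy → decidable-stable (y ∈? K) λ y∉K → none (y , wy , y∉K)

-- For a clique `M` this expresses that `M m` has no neighbour in the component of `x` in G - M.
Separates : SimpleGraph n → (Fin (suc k) → Fin n) → Fin n → Set
Separates {n} {k} G M x = Σ (Fin (suc k)) λ m → Σ (Fin n → Bool) λ D →
  D x ≡ true × D (M m) ≡ false × Closed G (removeAt M m) D

-- The last alternative serves `x` = `w`: `extend-closed` puts `w` on the side of its neighbour `y`.
extend-separates : (G : SimpleGraph (suc n)) (w : Fin (suc n)) → NbhdIsClique G w →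
  (M : Fin (suc k) → Fin (suc n)) (w∉M : w ∉ M) (y : Fin n) →
  Separates (delete G w) (lower M w∉M) y → ∀ x →
  x ≡ punchIn w y ⊎ (x ≡ w × adj G w (punchIn w y) ≡ true) → Separates G M x
extend-separates G w simp M w∉M y (m , D , Dy , Dm , c) x x-y
  with extend-closed G w simp _ D c
... | D′ , c′ , old , new =
  m , D′ , D′x x-y
  , trans (cong D′ (≡-sym (punchIn-lower G M w∉M m))) (trans (old _) Dm)
  , closed-cong (λ i → punchIn-lower G M w∉M _) c′
  where
  D′x : x ≡ punchIn w y ⊎ (x ≡ w × adj G w (punchIn w y) ≡ true) → D′ x ≡ true
  D′x (inj₁ refl)        = trans (old y) Dy
  D′x (inj₂ (refl , wy)) = new y wy Dy

-- If `e` missed `K i`, its `b` distinct values would all lie among the other `b` - 1 entries of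
-- `K`.
covers⇒covered : (e K : Fin b → Fin n) → Injective _≡_ _≡_ e → (∀ l → e l ∈ K) → ∀ i → K i ∈ e
covers⇒covered {suc b} e K inj e⊆K i with K i ∈? e
... | yes Ki∈e = Ki∈e
... | no Ki∉e with overflow e (removeAt K i) inj ≤-refl
...   | l , el∉ = let j , eq = ∈-removeAt i (e⊆K l) (λ Ki≡el → Ki∉e (l , ≡-sym Ki≡el))
                  in contradiction eq (el∉ j)

-- Without `w`, only `b` - 1 entries of `K` remain, too few for the `b` distinct values of `e`.
escape : (e K : Fin b → Fin n) → Injective _≡_ _≡_ e → ∀ {w} → w ∈ K → w ∉ e → ∃ λ i → e i ∉ K
escape {suc b} e K inj (j , refl) w∉e with overflow e (removeAt K j) inj ≤-refl
... | i , ei∉ = i , λ l eq →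
  let l′ , eq′ = ∈-removeAt j (l , eq) (λ Kj≡ei → w∉e i (≡-sym Kj≡ei)) in ei∉ l′ eq′

-- The other `k` vertices of `M` are distinct neighbours of `M m`, so they already exhaust its
-- neighbourhood.
nbhd⊆clique : (G : SimpleGraph n) {M : Fin (suc k) → Fin n} → IsClique G M →
  ∀ m → ∣ nbhd G (M m) ∣ ≡ k → ∀ y → adj G (M m) y ≡ true → y ∈ M
nbhd⊆clique G {M} cl m size y wy with y ∈? M | nbhd-enumeration G (M m) size
... | yes y∈M | _ = y∈M
... | no y∉M  | e , E
  with overflow (y ∷ removeAt M m) e
         (∷-injective (λ i eq → y∉M (_ , eq)) (clique-injective G (removeAt-clique G cl m))) ≤-refl
...   | zero  , y∉e = let i , eq = Enumerates.complete E y wy in contradiction eq (y∉e i)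
...   | suc i , z∉e = let j , eq = Enumerates.complete E _ (cl m _ (punchInᵢ≢i m i ∘ ≡-sym))
                      in contradiction eq (z∉e j)

-- If w ∈ M, then M = N[w], so everything outside M is separated from w.
separation : (G : SimpleGraph n) → KTree k n G → (M : Fin (suc k) → Fin n) → IsClique G M →
  ∀ x → x ∉ M → Separates G M x
separation G (clique .G _) M cl x x∉M =
  contradiction (injective⇒≤ (clique-injective G cl)) (n≮n _)
separation G (extend .G w simp size T) M cl x x∉M with ∈⊎∉ w M
... | inj₁ (m , refl) =
  m , outside M , outside-∉ x∉M , outside-∈ M (m , refl) , record
    { avoids = λ i → outside-∈ M (_ , refl) ; absorb = absorb }
  where
  out = outside-closed G M
  absorb : ∀ u t → outside M u ≡ true → adj G u t ≡ true → t ∉ removeAt M m → outside M t ≡ true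
  absorb u t Du ut t∉ with M m ≟ t
  ... | yes refl = let i , eq = nbhd⊆clique G cl m size u (adj-sym G ut)
                   in contradiction eq (Closed.disjoint out Du i)
  ... | no Mm≢t  = outside-∉ λ i eq →
          let j , eq′ = ∈-removeAt m (i , eq) Mm≢t in t∉ j eq′
... | inj₂ w∉M with punchView w x
...   | miss y = extend-separates G w simp M w∉M y
          (separation _ T (lower M w∉M) (lower-clique G M w∉M cl) y (∉-lower G M w∉M x∉M)) _ (inj₁ refl)
...   | hit with nbhd⊆⊎⊈ G w {M}
...     | inj₂ (y , wy , y∉M) with punchView w y
...       | hit    = contradiction refl (adj⇒≢ G wy)
...       | miss y = extend-separates G w simp M w∉M y
          (separation _ T (lower M w∉M) (lower-clique G M w∉M cl) y (∉-lower G M w∉M y∉M)) _ (inj₂ (refl , wy))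
separation G (extend .G w simp size T) M cl x x∉M | inj₂ w∉M | hit | inj₁ N⊆M
  with nbhd-enumeration G w size
-- `M` has one vertex more than N(w), so some `M m` is not adjacent to `w`. Then N(w) lies in the
-- rest of `M`, and the singleton of `w` is closed for that rest.
... | e , E with overflow M e (clique-injective G cl) ≤-refl
...   | m , Mm∉e = m , D , single-w , single-≢ (w∉M m) , record
          { avoids = λ i → single-≢ (w∉M _) ; absorb = absorb }
  where
  D : _ → Bool
  D u = ⌊ w ≟ u ⌋
  single-w : D w ≡ true
  single-w with w ≟ w
  ... | yes _  = refl
  ... | no w≢w = contradiction refl w≢w
  single-≢ : ∀ {u} → u ≢ w → D u ≡ false
  single-≢ {u} u≢w with w ≟ u
  ... | yes eq = contradiction (≡-sym eq) u≢w
  ... | no _   = refl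
  absorb : ∀ u t → D u ≡ true → adj G u t ≡ true → t ∉ removeAt M m → D t ≡ true
  absorb u t Du ut t∉ with w ≟ u
  ... | yes refl =
    let i , eq = Enumerates.complete E t ut
        j , eq′ = ∈-removeAt m (N⊆M t ut) (λ Mm≡t → Mm∉e i (trans eq (≡-sym Mm≡t)))
    in contradiction eq′ (t∉ j)

-- If w ∈ K, the vertex y of N(w) outside K works: a set closed for K that misses y is
-- closed for N(w) in G − w, so the apex over N(w), being adjacent to y, would put y into it.
apex : (G : SimpleGraph n) → KTree k n G → (K : Fin k → Fin n) → IsClique G K → ∀ x → x ∉ K →
  ∃ λ v → (∀ i → adj G v (K i) ≡ true) × (∀ D → Closed G K D → D x ≡ true → D v ≡ true)
apex G (clique .G _) K cl x x∉K =
  let i , eq = covers⇒covered K id (clique-injective G cl) (λ l → K l , refl) x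
  in contradiction eq (x∉K i)
apex G (extend .G w simp size T) K cl x x∉K with nbhd-enumeration G w size | ∈⊎∉ w K
... | e , E | inj₂ w∉K with punchView w x
...   | miss y =
  let v , vK , vD = apex _ T (lower K w∉K) (lower-clique G K w∉K cl) y (∉-lower G K w∉K x∉K)
  in punchIn w v , (λ i → lower-adj G K w∉K i (vK i)) , λ D c → vD _ (restrict-closed G K w∉K c)
...   | hit with nbhd⊆⊎⊈ G w {K}
-- N(w) lies in `K` and has the same size, so it is all of `K` and `w` itself is the apex.
...     | inj₁ N⊆K = w , (λ i → wK i (covers⇒covered e K E.injective (λ l → N⊆K _ (E.sound l)) i))
                   , λ _ _ Dw → Dw
  where
  module E = Enumerates E
  wK : ∀ i → K i ∈ e → adj G w (K i) ≡ true
  wK i (l , eq) = subst (λ t → adj G w t ≡ true) eq (E.sound l)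
...     | inj₂ (y , wy , y∉K) with punchView w y
...       | hit    = contradiction refl (adj⇒≢ G wy)
...       | miss y =
  let v , vK , vD = apex _ T (lower K w∉K) (lower-clique G K w∉K cl) y (∉-lower G K w∉K y∉K)
  in punchIn w v , (λ i → lower-adj G K w∉K i (vK i))
   , λ D c Dw → vD _ (restrict-closed G K w∉K c) (Closed.absorb c _ _ Dw wy y∉K)
apex G (extend .G w simp size T) K cl x x∉K | e , E | inj₁ (j , refl) = byCases (∈⊎∉ x e)
  where
  module E = Enumerates E
  w∉e : K j ∉ e
  w∉e i eq = adj⇒≢ G (E.sound i) (≡-sym eq)

  e-clique : IsClique G e
  e-clique i l i≢l = simp _ _ (E.sound i) (E.sound l) (i≢l ∘ E.injective)

  -- The rest of `K` lies in the clique N(w), so every neighbour of w = `K j` outside `K` is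
  -- adjacent to all of `K`.
  dominates : ∀ y → adj G (K j) y ≡ true → y ∉ K → ∀ i → adj G y (K i) ≡ true
  dominates y wy y∉K i with j ≟ i
  ... | yes refl = adj-sym G wy
  ... | no j≢i   = simp _ _ wy (cl j i j≢i) (λ eq → y∉K i (≡-sym eq))

  byCases : x ∈ e ⊎ x ∉ e → _
  byCases (inj₁ (i , refl)) = x , dominates x (E.sound i) x∉K , λ _ _ Dx → Dx
  byCases (inj₂ x∉e) = y , dominates y (E.sound iy) y∉K , reaches
    where
    iy = proj₁ (escape e K E.injective (j , refl) w∉e)
    y = e iy
    y∉K : y ∉ K
    y∉K = proj₂ (escape e K E.injective (j , refl) w∉e)

    reaches : ∀ D → Closed G K D → D x ≡ true → D y ≡ true
    reaches D c Dx with D y in Dy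
    ... | true  = refl
    ... | false with punchView (K j) x
    ...   | hit     = contradiction refl (x∉K j)
    ...   | miss x′ =
      let v , vK , vD = apex _ T (lower e w∉e) (lower-clique G e w∉e e-clique) x′
                          (∉-lower G e w∉e x∉e)
          Dv = vD _ D-closed-e Dx
      in contradiction Dy (true≢false (Closed.absorb c _ y Dv (lower-adj G e w∉e iy (vK iy)) y∉K))
      where
      -- A vertex of N(w) in `D` other than `y` is adjacent to `y` and would pull it into `D`.
      N∩D=∅ : ∀ i → D (e i) ≡ false
      N∩D=∅ i with D (e i) in Di
      ... | false = refl
      ... | true with e i ≟ y
      ...   | yes eq = contradiction Dy (true≢false (trans (cong D (≡-sym eq)) Di))
      ...   | no ≢y  = contradiction Dy (true≢false
                (Closed.absorb c _ _ Di (simp _ _ (E.sound i) (E.sound iy) ≢y) y∉K))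
      D-closed-e : Closed (delete G (K j)) (lower e w∉e) (D ∘ punchIn (K j))
      D-closed-e = record
        { avoids = λ i → trans (cong D (punchIn-lower G e w∉e i)) (N∩D=∅ i)
        ; absorb = λ u t Du ut t∉ → Closed.absorb c _ _ Du ut λ i eq → t∉K t t∉ i eq }
        where
        -- `K` consists of w and some of its neighbours, so avoiding w and N(w) is enough to avoid
        -- `K`.
        t∉K : ∀ t → t ∉ lower e w∉e → punchIn (K j) t ∉ K
        t∉K t t∉ i eq with j ≟ i
        ... | yes refl = punchInᵢ≢i (K j) t (≡-sym eq)
        ... | no j≢i   =
          let l , el≡ = E.complete _ (subst (λ z → adj G (K j) z ≡ true) eq (cl j i j≢i))
          in lower-∉ G e w∉e t∉ l el≡

-- Pieces of a path, and how a path stays in one component.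

subpath : (G : SimpleGraph n) {q : Fin b → Fin n} → IsPath G q →
  (h : Fin a → Fin b) (c : ℕ) → (∀ i → toℕ (h i) ≡ c + toℕ i) → IsPath G (q ∘ h)
subpath G (inj , step) h c shift =
  (λ {i} {j} eq → toℕ-injective (+-cancelˡ-≡ c _ _
    (trans (≡-sym (shift i)) (trans (cong toℕ (inj eq)) (shift j))))) ,
  λ i j j≡1+i → step _ _ (trans (shift j)
    (trans (cong (c +_) j≡1+i) (trans (+-suc c _) (cong suc (≡-sym (shift i))))))

module _ (G : SimpleGraph n) {K : Fin b → Fin n} {D : Fin n → Bool} (c : Closed G K D) where

  spread-from-head : {q : Fin (suc a) → Fin n} → IsPath G q → (∀ i → q i ∉ K) →
    D (q zero) ≡ true → ∀ i → D (q i) ≡ true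
  spread-from-head P q∉K D0 zero = D0
  spread-from-head {a = suc a} P q∉K D0 (suc i) =
    spread-from-head (subpath G P suc 1 λ _ → refl) (q∉K ∘ suc)
      (Closed.absorb c _ _ D0 (proj₂ P zero (suc zero) refl) (q∉K _)) i

  spread-to-head : {q : Fin (suc a) → Fin n} → IsPath G q → (∀ i → q i ∉ K) →
    ∀ i → D (q i) ≡ true → D (q zero) ≡ true
  spread-to-head P q∉K zero Di = Di
  spread-to-head {a = suc a} P q∉K (suc i) Di =
    Closed.absorb c _ _ (spread-to-head (subpath G P suc 1 λ _ → refl) (q∉K ∘ suc) i Di)
      (adj-sym G (proj₂ P zero (suc zero) refl)) (q∉K _)

  -- Going back to the head of the path and forward again spares a comparison of `i` with `l`.
  spread : {q : Fin a → Fin n} → IsPath G q → (∀ i → q i ∉ K) →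
    ∀ i l → D (q i) ≡ true → D (q l) ≡ true
  spread {a = suc a} P q∉K i l Di = spread-from-head P q∉K (spread-to-head P q∉K i Di) l

-- A path visits `v` at most once, so `v` is missing from one half. The index map is returned,
-- rather than a new path, so that facts about `q` carry over by composition.
halve : (G : SimpleGraph n) (s : ℕ) (q : Fin (2 ^ suc s) → Fin n) → IsPath G q → ∀ v →
  ∃ λ (h : Fin (2 ^ s) → Fin (2 ^ suc s)) → IsPath G (q ∘ h) × v ∉ (q ∘ h)
halve G s q P v with ∈⊎∉ v (q ∘ (_↑ˡ (2 ^ s + 0)))
... | inj₂ v∉ = (_↑ˡ (2 ^ s + 0)) , subpath G P _ 0 (λ i → toℕ-↑ˡ i _) , v∉
... | inj₁ (i , refl) = right , subpath G P right (2 ^ s) shift , λ l eq →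
    contradiction (cong toℕ (proj₁ P eq)) (λ eq′ →
      <⇒≱ (toℕ<n i) (subst (2 ^ s ≤_) (trans (≡-sym (shift l)) (trans eq′ (toℕ-↑ˡ i _))) (m≤m+n _ _)))
  where
  right : Fin (2 ^ s) → Fin (2 ^ suc s)
  -- `2 ^ suc s` unfolds to `2 ^ s + (2 ^ s + 0)`, hence the `↑ˡ 0`.
  right l = 2 ^ s ↑ʳ (l ↑ˡ 0)
  shift : ∀ l → toℕ (right l) ≡ 2 ^ s + toℕ l
  shift l = trans (toℕ-↑ʳ (2 ^ s) _) (cong (2 ^ s +_) (toℕ-↑ˡ l 0))

avoid : (G : SimpleGraph n) (b s : ℕ) (K : Fin b → Fin n) (q : Fin (2 ^ (b + s)) → Fin n) →
  IsPath G q → ∃ λ (r : Fin (2 ^ s) → Fin n) → IsPath G r × (∀ i → r i ∉ K)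
avoid G b s K q P with shrink b K q P
  where
  shrink : ∀ b (K : Fin b → Fin _) (q : Fin (2 ^ (b + s)) → Fin _) → IsPath G q →
    ∃ λ (h : Fin (2 ^ s) → Fin (2 ^ (b + s))) → IsPath G (q ∘ h) × (∀ i → q (h i) ∉ K)
  shrink zero    K q P = id , P , λ _ ()
  shrink (suc b) K q P with halve G (b + s) q P (K zero)
  ... | h , P′ , K0∉ with shrink b (K ∘ suc) (q ∘ h) P′
  ...   | h′ , P″ , ∉K = h ∘ h′ , P″ , λ { i zero eq → K0∉ (h′ i) (≡-sym eq) ; i (suc j) → ∉K i j }
... | h , P′ , ∉K = q ∘ h , P′ , ∉K

-- For a variable `s`, `2 ^ s` is not visibly a successor, so `zero` cannot be used directly as an
-- index.
2^-first : ∀ s → Fin (2 ^ s)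
2^-first zero    = zero
2^-first (suc s) = 2^-first s ↑ˡ _

-- Growing a rooted induced path by recursion on the budgets.

singleton-induced : (G : SimpleGraph n) (v : Fin n) → IsInducedPath {p = 1} G (const v)
singleton-induced G v =
  ((λ { {zero} {zero} _ → refl }) , λ { zero zero () }) ,
  λ { zero zero vv → contradiction refl (adj⇒≢ G vv) }

∷-induced : (G : SimpleGraph n) {u : Fin n} {g : Fin (suc m) → Fin n} → IsInducedPath G g →
  adj G u (g zero) ≡ true → (∀ i → adj G u (g (suc i)) ≡ false) → u ∉ g → IsInducedPath G (u ∷ g)
∷-induced {m = m} G {u} {g} ((inj , step) , ind) uv far u∉g =
  (∷-injective u∉g inj , step′) , ind′
  where
  step′ : ∀ i j → toℕ j ≡ suc (toℕ i) → adj G ((u ∷ g) i) ((u ∷ g) j) ≡ true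
  step′ zero    (suc zero) _  = uv
  step′ (suc i) (suc j)    eq = step i j (ℕ-suc-injective eq)
  ind′ : ∀ i j → adj G ((u ∷ g) i) ((u ∷ g) j) ≡ true → toℕ j ≡ suc (toℕ i) ⊎ toℕ i ≡ suc (toℕ j)
  ind′ zero          zero          uu = contradiction refl (adj⇒≢ G uu)
  ind′ zero          (suc zero)    _  = inj₁ refl
  ind′ zero          (suc (suc j)) uj = contradiction (far j) (true≢false uj)
  ind′ (suc zero)    zero          _  = inj₂ refl
  ind′ (suc (suc i)) zero          iu = contradiction (far i) (true≢false (adj-sym G iu))
  ind′ (suc i)       (suc j)       ij = Sum.map (cong suc) (cong suc) (ind i j ij)

-- The only exit from `D` that the new clique does not block is `K j`, and `D′` misses it.
∩-closed : (G : SimpleGraph n) {K : Fin (suc k) → Fin n} {v : Fin n} {j : Fin (suc k)}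
  {D D′ : Fin n → Bool} → Closed G K D → Closed G (removeAt (v ∷ K) (suc j)) D′ → D′ (K j) ≡ false →
  Closed G (removeAt (v ∷ K) (suc j)) (λ u → D u ∧ D′ u)
∩-closed G {K} {v} {j} {D} {D′} c c′ D′Kj = record { avoids = avoids ; absorb = absorb }
  where
  avoids : ∀ i → D (removeAt (v ∷ K) (suc j) i) ∧ D′ (removeAt (v ∷ K) (suc j) i) ≡ false
  avoids i = trans (cong (D _ ∧_) (Closed.avoids c′ i)) (∧-zeroʳ _)
  absorb : ∀ u t → D u ∧ D′ u ≡ true → adj G u t ≡ true → t ∉ removeAt (v ∷ K) (suc j) → D t ∧ D′ t ≡ true
  absorb u t DD′u ut t∉ = cong₂ _∧_ (Closed.absorb c u t (∧-conicalˡ _ _ DD′u) ut t∉K) D′t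
    where
    D′t : D′ t ≡ true
    D′t = Closed.absorb c′ u t (∧-conicalʳ _ _ DD′u) ut t∉
    t∉K : t ∉ K
    t∉K i eq with K j ≟ t
    ... | yes refl = true≢false D′t D′Kj
    ... | no Kj≢t  = let l , eq′ = ∈-removeAt j (i , eq) Kj≢t in t∉ (suc l) eq′

-- `s` is kept apart from `sum β` so that the recursion is structural in it and `2 ^ s` unfolds. The
-- claim that `g` stays in `D` is carried along because prolonging a path by `K j` relies on it.
rooted-induced-path : (G : SimpleGraph n) → KTree (suc k) n G →
  ∀ s (K : Fin (suc k) → Fin n) → IsClique G K → (β : Fin (suc k) → ℕ) → sum β ≡ s →
  (D : Fin n → Bool) → Closed G K D →
  (q : Fin (2 ^ s) → Fin n) → IsPath G q → (∀ i → D (q i) ≡ true) →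
  ∃ λ j → ∃ λ m → ∃ λ (g : Fin m → Fin n) →
    β j < m × IsInducedPath G (K j ∷ g) × (∀ i → D (g i) ≡ true)
rooted-induced-path {n} G T s K cl β Σβ D c q P q∈D
  with apex G T K cl (q (2^-first s)) (Closed.disjoint c (q∈D _))
-- Quantifying over all closed sets, `reach` says that `v` lies in the component of the first path
-- vertex in G - K. Below it is applied to `D′` as well as to `D`.
... | v , vK , reach with any? (λ j → β j ℕ.≟ 0)
...   | yes (j , βj≡0) = j , 1 , const v , subst (_< 1) (≡-sym βj≡0) ≤-refl
        , ∷-induced G (singleton-induced G v) (adj-sym G (vK j)) (λ ())
            (λ _ → adj⇒≢ G (vK j))
        , λ _ → reach D c (q∈D _)
...   | no β>0 = descend s Σβ q P q∈D reach
  where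
  Goal : Set
  Goal = ∃ λ j → ∃ λ m → ∃ λ (g : Fin m → Fin n) →
    β j < m × IsInducedPath G (K j ∷ g) × (∀ i → D (g i) ≡ true)

  pos : ∀ j → suc (ℕ.pred (β j)) ≡ β j
  pos j with β j in eq
  ... | zero  = contradiction (j , eq) β>0
  ... | suc _ = refl

  -- `s` occurs in the type of `q`, so matching on it requires `q` and the facts about it to be
  -- generalised.
  descend : ∀ s → sum β ≡ s → (q : Fin (2 ^ s) → Fin n) → IsPath G q → (∀ i → D (q i) ≡ true) →
    (∀ D → Closed G K D → D (q (2^-first s)) ≡ true → D v ≡ true) → Goal
  descend zero Σβ q P q∈D reach = contradiction (zero , m+n≡0⇒m≡0 _ Σβ) β>0
  descend (suc s) Σβ q P q∈D reach with halve G s q P v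
  ... | h , P′ , v∉ with separation G T (v ∷ K) (∷-clique G vK cl) (q (h (2^-first s)))
          (λ { zero eq → v∉ _ (≡-sym eq) ; (suc i) eq → Closed.disjoint c (q∈D _) i eq })
  -- Index `zero` would separate `v` from the path by `K` alone. But `spread` puts the first vertex
  -- of `q` into `D′`, and `reach` then puts `v` there.
  ...   | zero , D′ , D′x , D′v , c′ = contradiction D′v (true≢false
            (reach D′ c′ (spread G c′ P (λ i → Closed.disjoint c (q∈D i)) _ _ D′x)))
  ...   | suc j , D′ , D′x , D′Kj , c′
    with rooted-induced-path G T s (removeAt (v ∷ K) (suc j))
           (removeAt-clique G (∷-clique G vK cl) (suc j))
           -- `v` replaces `K j` and takes over its budget lowered by one, so the total drops from
           -- `suc s` to `s`.
           (removeAt (ℕ.pred (β j) ∷ β) (suc j)) Σβ′ _ (∩-closed G c c′ D′Kj)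
           (q ∘ h) P′ (λ i → cong₂ _∧_ (q∈D _) (spread G c′ P′ q′∉ _ i D′x))
    where
    Σβ′ : ℕ.pred (β j) + sum (removeAt β j) ≡ s
    Σβ′ = ℕ-suc-injective (trans (cong (_+ sum (removeAt β j)) (pos j)) (trans (≡-sym (sum-remove β)) Σβ))
    q′∉ : ∀ i → q (h i) ∉ removeAt (v ∷ K) (suc j)
    q′∉ i zero    eq = v∉ i (≡-sym eq)
    q′∉ i (suc l) eq = Closed.disjoint c (q∈D (h i)) _ eq
  -- The root is a vertex kept from `K`; its budget is unchanged and the path serves as it is.
  ...     | suc i , m , g , β< , ind , g∈ =
    punchIn j i , m , g , β< , ind , λ l → ∧-conicalˡ _ _ (g∈ l)
  -- The root is `v`: prepending `K j` makes up for the unit taken from its budget.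
  ...     | zero , m , g , β< , ind , g∈ =
    j , suc m , v ∷ g , subst (_< suc m) (pos j) (s≤s β<)
    , ∷-induced G ind (adj-sym G (vK j)) far Kj∉
    , λ { zero → reach D c (q∈D _) ; (suc l) → ∧-conicalˡ _ _ (g∈ l) }
    where
    Kj∉D′ : ∀ l → g l ≢ K j
    Kj∉D′ l eq = true≢false (∧-conicalʳ _ _ (g∈ l)) (trans (cong D′ eq) D′Kj)
    -- A neighbour of `K j` in `D′` would force `K j` into `D′`.
    far : ∀ l → adj G (K j) (g l) ≡ false
    far l = ¬-not λ Kj-gl → true≢false
      (Closed.absorb c′ _ _ (∧-conicalʳ _ _ (g∈ l)) (adj-sym G Kj-gl)
        λ { zero eq → adj⇒≢ G (vK j) eq
          ; (suc i) eq → punchInᵢ≢i j i (clique-injective G cl eq) })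
      D′Kj
    Kj∉ : K j ∉ (v ∷ g)
    Kj∉ zero    = adj⇒≢ G (vK j)
    Kj∉ (suc l) = Kj∉D′ l

-- Equal budgets and the logarithmic bound.

root-clique : (G : SimpleGraph n) → KTree k n G → ∃ λ (K : Fin k → Fin n) → IsClique G K
root-clique G (clique .G complete) = id , complete
root-clique G (extend .G w _ _ T) =
  let K , cl = root-clique _ T in punchIn w ∘ K , cl

sum-const : ∀ b c → sum {b} (const c) ≡ b * c
sum-const zero    c = refl
sum-const (suc b) c = cong (c +_) (sum-const b c)

-- Of the exponent `suc k * suc r`, one `suc k` pays for avoiding a clique and the remaining
-- `suc k * r` for budgets of `r` each. The root then turns more than `r` vertices into more than
-- `suc r`.
induced-path : (G : SimpleGraph n) → KTree (suc k) n G → ∀ r (f : Fin a → Fin n) → IsPath G f →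
  2 ^ (suc k * r) ≤ a →
  ∃ λ p → ∃ λ (g : Fin p → Fin n) → IsInducedPath G g × r < p
induced-path {k = k} G T zero f P 2^≤a =
  1 , _ , singleton-induced G (f (inject≤ (2^-first (suc k * 0)) 2^≤a)) , ≤-refl
induced-path {k = k} G T (suc r) f P 2^≤a =
  let K , cl = root-clique G T
      exp    = cong (2 ^_) (≡-sym (*-suc (suc k) r))
      2^≤a′  = ≤-trans (≤-reflexive exp) 2^≤a
      q , Pq , q∉K = avoid G (suc k) (suc k * r) K (λ i → f (inject≤ i 2^≤a′))
                       (subpath G P _ 0 λ i → toℕ-inject≤ i 2^≤a′)
      j , m , g , r<m , ind , _ = rooted-induced-path G T _ K cl (const r) (sum-const (suc k) r)
                       _ (outside-closed G K) q Pq (λ i → outside-∉ (q∉K i))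
  in suc m , K j ∷ g , ind , s≤s r<m

-- `r` is the integer part of the logarithm of `n` to base `c`.
power-bracket : ∀ c → 2 ≤ c → ∀ n → 1 ≤ n → ∃ λ r → c ^ r ≤ n × n < c ^ suc r
power-bracket c 2≤c (suc zero) _ = 0 , ≤-refl , ≤-trans 2≤c (≤-reflexive (≡-sym (*-identityʳ c)))
power-bracket c 2≤c (suc n@(suc _)) _ with power-bracket c 2≤c n (s≤s z≤n)
... | r , c^r≤n , n<c^1+r with suc n <? c ^ suc r
...   | yes lt = r , m≤n⇒m≤1+n c^r≤n , lt
-- `suc n` has reached the next power of `c`; it stays below the one after because `c` is at least
-- 2.
...   | no ≮   = suc r , ≮⇒≥ ≮ , (begin-strict
    suc n                   <⟨ s≤s n<c^1+r ⟩
    1 + c ^ suc r           ≤⟨ +-monoˡ-≤ (c ^ suc r) (m^n>0 c (suc r)) ⟩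
    c ^ suc r + c ^ suc r   ≡⟨ cong (c ^ suc r +_) (≡-sym (+-identityʳ _)) ⟩
    2 * c ^ suc r           ≤⟨ *-monoˡ-≤ (c ^ suc r) 2≤c ⟩
    c * c ^ suc r           ∎)
  where
  open ≤-Reasoning
  instance
    c≢0 : NonZero c
    c≢0 = >-nonZero (<⇒≤ 2≤c)

-- The bound log (n - k - 1) / (k log k) ≤ p is exponentiated to stay within the naturals;
-- `k + 2 ≤ n` gives the logarithm a positive argument.
theorem3 : (k : ℕ) → 2 ≤ k → (N : ℕ) (G : SimpleGraph N) → KTree k N G →
    (n : ℕ) (f : Fin n → Fin N) → IsPath G f → k + 2 ≤ n →
    Σ ℕ (λ p → Σ (Fin p → Fin N) (λ g →
    IsInducedPath G g × n ∸ k ∸ 1 ≤ k ^ (k * p)))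
theorem3 k@(suc k′) 2≤k N G T n f P k+2≤n
  -- With base `2 ^ k`, `r` is the integer part of (log n) / k. The path found has more than `r`
  -- vertices, and this surplus absorbs the rounding.
  with power-bracket (2 ^ k) (^-monoʳ-≤ 2 {1} {k} (s≤s z≤n)) n (≤-trans (s≤s z≤n) k+2≤n)
... | r , lower-bound , upper-bound
  with induced-path G T r f P (subst (_≤ n) (^-*-assoc 2 k r) lower-bound)
...   | p , g , ind , r<p = p , g , ind , (begin
    n ∸ k ∸ 1         ≤⟨ ≤-trans (m∸n≤m (n ∸ k) 1) (m∸n≤m n k) ⟩
    n                 ≤⟨ <⇒≤ upper-bound ⟩
    (2 ^ k) ^ suc r   ≡⟨ ^-*-assoc 2 k (suc r) ⟩
    2 ^ (k * suc r)   ≤⟨ ^-monoʳ-≤ 2 (*-monoʳ-≤ k r<p) ⟩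
    2 ^ (k * p)       ≤⟨ ^-monoˡ-≤ (k * p) 2≤k ⟩
    k ^ (k * p)       ∎)
  where open ≤-Reasoning
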